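{- Up to isomorphism of signed graphs, there are exactly two connected strongly regular signed graphs that are $5$-regular and $1$ net-regular, namely: (i) $\dot G_2$: the complete graph $K_6$ in which the negative edges form two vertex-disjoint triangles and all other edges are positive (parameters $(n,r,a,b)=(6,5,-4,4)$); (ii) $\dot S^1_{12}$: the signed graph with vertex set $\{1,2,3,4\}\times\{1,2,3\}$, where $(p,q)(p',q)$ is a positive edge whenever $p\neq p'$, $(p,q)(p,q')$ is a negative edge whenever $q\ne q'$, and there are no other edges (so the positive edges form $3K_4$ and the negative edges form $4K_3$; parameters $(12,5,2,1,-2)$).
   Context: A signed graph $\dot G=(G,\sigma)$ is a simple graph $G$ (its underlying graph) with a sign function $\sigma:E(G)\to\{+1,-1\}$. Its adjacency matrix $A_{\dot G}=(a_{ij})$ has $a_{ij}=\sigma(v_iv_j)$ if $v_i\sim v_j$ and $0$ otherwise. The degree of a vertex is its degree in $G$; $d^+(v)$ and $d^-(v)$ are the numbers of positive and negative edges at $v$; the net-degree of $v$ is $d^+(v)-d^-(v)$, and $\dot G$ is $\rho$ net-regular if every vertex has net-degree $\rho$. Connectedness and completeness refer to the underlying graph. $\dot G$ is homogeneous if all its edges have the same sign. A signed graph $\dot G$ on $n$ vertices is strongly regular (an SRSG) if it is neither homogeneous complete nor edgeless and there exist $r\in\mathbb{N}$ and $a,b,c\in\mathbb{Z}$ such that the entries of $A_{\dot G}^2$ satisfy: $(A^2_{\dot G})_{ii}=r$; $(A^2_{\dot G})_{ij}=a$ if $v_iv_j$ is a positive edge; $=b$ if $v_iv_j$ is a negative edge;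 $=c$ if $v_i\neq v_j$ are non-adjacent. Its parameters are written $(n,r,a,b,c)$, or $(n,r,a,b)$ if $\dot G$ is complete. Two signed graphs are isomorphic if there is an isomorphism of underlying graphs preserving edge signs. -}

module Defs where

open import Data.Nat using (ℕ; zero; suc; _<ᵇ_)
open import Data.Integer using (ℤ; +_; -_; _+_; _*_)
open import Data.Fin using (Fin; zero; suc; toℕ; _≟_; remQuot)
open import Data.Bool using (Bool; true; false; if_then_else_)
open import Data.Product using (Σ; _×_; _,_; ∃; ∃-syntax; proj₁; proj₂)
open import Data.Sum using (_⊎_)
open import Relation.Nullary using (¬_; does)
open import Relation.Binary.PropositionalEquality using (_≡_; _≢_)
import Data.Bool.Properties
open import Function.Bundles using (_↔_; Inverse)

data EdgeSign : Set where
  pos neg none : EdgeSign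

RawSG : ℕ → Set
RawSG n = Fin n → Fin n → EdgeSign

IsSignedGraph : ∀ {n} → RawSG n → Set
IsSignedGraph {n} σ = (∀ (i j : Fin n) → σ i j ≡ σ j i) × (∀ (i : Fin n) → σ i i ≡ none)

adjEntry : EdgeSign → ℤ
adjEntry pos  = + 1
adjEntry neg  = - (+ 1)
adjEntry none = + 0

adj : ∀ {n} → RawSG n → Fin n → Fin n → ℤ
adj σ i j = adjEntry (σ i j)

∑ℤ : ∀ n → (Fin n → ℤ) → ℤ
∑ℤ zero    f = + 0
∑ℤ (suc n) f = f zero + ∑ℤ n (λ k → f (suc k))

∑ℕ : ∀ n → (Fin n → ℕ) → ℕ
∑ℕ zero    f = 0
∑ℕ (suc n) f = f zero Data.Nat.+ ∑ℕ n (λ k → f (suc k))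

adj² : ∀ {n} → RawSG n → Fin n → Fin n → ℤ
adj² {n} σ i j = ∑ℤ n (λ k → adj σ i k * adj σ k j)

isEdge : EdgeSign → ℕ
isEdge none = 0
isEdge _    = 1

degree : ∀ {n} → RawSG n → Fin n → ℕ
degree {n} σ v = ∑ℕ n (λ k → isEdge (σ v k))

netDegree : ∀ {n} → RawSG n → Fin n → ℤ
netDegree {n} σ v = ∑ℤ n (λ k → adj σ v k)

Regular : ∀ {n} → ℕ → RawSG n → Set
Regular {n} r σ = ∀ (v : Fin n) → degree σ v ≡ r

NetRegular : ∀ {n} → ℤ → RawSG n → Set
NetRegular {n} ρ σ = ∀ (v : Fin n) → netDegree σ v ≡ ρ

data Reach {n} (σ : RawSG n) (i : Fin n) : Fin n → Set where
  here : Reach σ i i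
  step : ∀ {j k} → Reach σ i j → σ j k ≢ none → Reach σ i k

Connected : ∀ {n} → RawSG n → Set
Connected {n} σ = ∀ (i j : Fin n) → Reach σ i j

Complete : ∀ {n} → RawSG n → Set
Complete {n} σ = ∀ (i j : Fin n) → i ≢ j → σ i j ≢ none

Homogeneous : ∀ {n} → RawSG n → Set
Homogeneous {n} σ = (∀ (i j : Fin n) → σ i j ≢ neg) ⊎ (∀ (i j : Fin n) → σ i j ≢ pos)

Edgeless : ∀ {n} → RawSG n → Set
Edgeless {n} σ = ∀ (i j : Fin n) → σ i j ≡ none

SRSGParams : ∀ {n} → RawSG n → ℕ → ℤ → ℤ → ℤ → Set
SRSGParams {n} σ r a b c =
  (∀ (i : Fin n) → adj² σ i i ≡ + r) ×
  (∀ (i j : Fin n) → σ i j ≡ pos → adj² σ i j ≡ a) ×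
  (∀ (i j : Fin n) → σ i j ≡ neg → adj² σ i j ≡ b) ×
  (∀ (i j : Fin n) → i ≢ j → σ i j ≡ none → adj² σ i j ≡ c)

StronglyRegular : ∀ {n} → RawSG n → Set
StronglyRegular σ =
  ¬ (Homogeneous σ × Complete σ) × ¬ Edgeless σ ×
  Σ ℕ (λ r → Σ ℤ (λ a → Σ ℤ (λ b → Σ ℤ (λ c → SRSGParams σ r a b c))))

Iso : ∀ {n m} → RawSG n → RawSG m → Set
Iso {n} {m} σ τ = Σ (Fin n ↔ Fin m) (λ f →
  ∀ (i j : Fin n) → σ i j ≡ τ (Inverse.to f i) (Inverse.to f j))

Target : ∀ {n} → RawSG n → Set
Target σ = IsSignedGraph σ × Connected σ × StronglyRegular σ × Regular 5 σ × NetRegular (+ 1) σ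

-- Ġ₂: K₆ with negative edges forming the triangles {0,1,2} and {3,4,5}.
G₂ : RawSG 6
G₂ i j = if does (i ≟ j) then none
         else (if does (Data.Bool.Properties._≟_ (toℕ i <ᵇ 3) (toℕ j <ᵇ 3)) then neg else pos)

S₁₂ : RawSG 12
S₁₂ i j with remQuot {4} 3 i | remQuot {4} 3 j
... | (p , q) | (p' , q') =
  if does (q ≟ q') then (if does (p ≟ p') then none else pos)
  else (if does (p ≟ p') then neg else none)

{-# OPTIONS --safe #-}

-- In a 5-regular signed graph of net-degree 1 every vertex has three positive and two negative edges, and
-- every entry of A² lies in [-5, 5]. The all-ones vector is an eigenvector of A with eigenvalue 1, so the
-- row sums of A² give 5 + 3a + 2b + mc = 1, where m counts the vertices not adjacent to a given one. For
-- each of the finitely many triples (a, b, c) allowed by this equation, the signed graph is explored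
-- outwards from one vertex: the vertices met so far carry a table of known adjacencies, an unknown entry
-- is resolved by trying all three values, and a vertex whose row is completely known but lacks neighbours
-- receives a new one. A branch dies when some entry of A² can no longer take its prescribed value. Every
-- branch either dies or closes up, and then connectedness identifies the signed graph with the table,
-- which is a copy of Ġ₂ or Ṡ¹₁₂.

module Submission where

open import Defs
open import Data.Bool using (Bool; true; false; T; if_then_else_; _∧_; _∨_; not)
open import Data.Bool.Properties using (T?; T-∨)
open import Data.Fin using (Fin; zero; suc; punchIn; punchOut)
open import Data.Fin.Permutation using (↔⇒≡)
open import Data.Fin.Properties
  using (_≟_; any?; all?; punchInᵢ≢i; punchIn-injective; punchIn-punchOut; punchOut-injective)
open import Data.Integer as ℤ using (ℤ; ∣_∣) renaming (+_ to ⁺_)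
import Data.Integer.Properties as ℤ
open import Data.List using (List; []; _∷_; concatMap; allFin; filterᵇ; head)
import Data.List as List
open import Data.Maybe using (Maybe; just; nothing; maybe)
import Data.Maybe.Properties as Maybe
open import Data.Nat using (ℕ; zero; suc; _+_; _*_; _∸_; _≤_; _<_; _≤ᵇ_; _<ᵇ_; _≡ᵇ_; z≤n; s≤s)
open import Data.Nat.Properties as ℕ hiding (_≟_)
open import Data.Nat.Solver using (module +-*-Solver)
open import Data.Product using (Σ; _×_; _,_; ∃; proj₁; proj₂)
open import Data.Sum as ⊎ using (_⊎_; inj₁; inj₂)
open import Data.Unit using (tt)
open import Data.Vec using (Vec; []; _∷_; lookup; _[_]%=_; _[_]≔_; zipWith; map)
open import Data.Vec.Properties using (lookup-map; lookup-zipWith)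
open import Function using (_∘_; _$_; id)
open import Function.Bundles using (Equivalence; mk↔ₛ′)
open import Relation.Binary.Definitions using (DecidableEquality; tri<; tri≈; tri>)
open import Relation.Binary.PropositionalEquality
open import Relation.Nullary using (¬_; Dec; yes; no; does; contradiction)
open import Relation.Nullary.Decidable using (_×-dec_; _⊎-dec_; _→-dec_; ¬?; isYes; toWitness)
import Algebra.Properties.CommutativeMonoid.Sum +-0-commutativeMonoid as Sum

private
  variable
    k m n : ℕ

-- Finite sums

∑ℕ≡sum : ∀ n (f : Fin n → ℕ) → ∑ℕ n f ≡ Sum.sum f
∑ℕ≡sum zero    f = refl
∑ℕ≡sum (suc n) f = cong (f zero +_) (∑ℕ≡sum n (f ∘ suc))

∑ℕ-cong : {f g : Fin n → ℕ} → (∀ i → f i ≡ g i) → ∑ℕ n f ≡ ∑ℕ n g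
∑ℕ-cong {zero}  f≗g = refl
∑ℕ-cong {suc n} f≗g = cong₂ _+_ (f≗g zero) (∑ℕ-cong (f≗g ∘ suc))

∑ℕ-mono : {f g : Fin n → ℕ} → (∀ i → f i ≤ g i) → ∑ℕ n f ≤ ∑ℕ n g
∑ℕ-mono {zero}  f≤g = z≤n
∑ℕ-mono {suc n} f≤g = +-mono-≤ (f≤g zero) (∑ℕ-mono (f≤g ∘ suc))

∑ℕ-const : ∀ n c → ∑ℕ n (λ _ → c) ≡ n * c
∑ℕ-const zero    c = refl
∑ℕ-const (suc n) c = cong (c +_) (∑ℕ-const n c)

∑ℕ-zero : {f : Fin n → ℕ} → (∀ i → f i ≡ 0) → ∑ℕ n f ≡ 0
∑ℕ-zero {n} f≗0 = trans (∑ℕ-cong f≗0) (trans (∑ℕ-const n 0) (*-zeroʳ n))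

∑ℕ-positive : ∀ n (f : Fin n → ℕ) → 0 < ∑ℕ n f → ∃ λ i → 0 < f i
∑ℕ-positive (suc n) f 0<∑ with f zero in eq
... | suc _ = zero , subst (0 <_) (sym eq) (s≤s z≤n)
... | zero  with ∑ℕ-positive n (f ∘ suc) 0<∑
...   | i , 0<fi = suc i , 0<fi

∑ℕ-+ : ∀ (f g : Fin n → ℕ) → ∑ℕ n (λ i → f i + g i) ≡ ∑ℕ n f + ∑ℕ n g
∑ℕ-+ {n} f g = begin
  ∑ℕ n (λ i → f i + g i)      ≡⟨ ∑ℕ≡sum n (λ i → f i + g i) ⟩
  Sum.sum (λ i → f i + g i)   ≡⟨ Sum.∑-distrib-+ f g ⟩
  Sum.sum f + Sum.sum g       ≡⟨ cong₂ _+_ (∑ℕ≡sum n f) (∑ℕ≡sum n g) ⟨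
  ∑ℕ n f + ∑ℕ n g             ∎
  where open ≡-Reasoning

∑ℕ-comm : ∀ (f : Fin m → Fin n → ℕ) → ∑ℕ m (λ i → ∑ℕ n (f i)) ≡ ∑ℕ n (λ j → ∑ℕ m (λ i → f i j))
∑ℕ-comm {m} {n} f = begin
  ∑ℕ m (λ i → ∑ℕ n (f i))                  ≡⟨ ∑ℕ-cong (λ i → ∑ℕ≡sum n (f i)) ⟩
  ∑ℕ m (λ i → Sum.sum (f i))               ≡⟨ ∑ℕ≡sum m _ ⟩
  Sum.sum (λ i → Sum.sum (f i))            ≡⟨ Sum.∑-comm f ⟩
  Sum.sum (λ j → Sum.sum (λ i → f i j))    ≡⟨ ∑ℕ≡sum n _ ⟨
  ∑ℕ n (λ j → Sum.sum (λ i → f i j))       ≡⟨ ∑ℕ-cong (λ j → sym (∑ℕ≡sum m (λ i → f i j))) ⟩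
  ∑ℕ n (λ j → ∑ℕ m (λ i → f i j))          ∎
  where open ≡-Reasoning

∑ℕ-remove : ∀ (i : Fin (suc n)) (f : Fin (suc n) → ℕ) → ∑ℕ (suc n) f ≡ f i + ∑ℕ n (f ∘ punchIn i)
∑ℕ-remove {n} i f = begin
  ∑ℕ (suc n) f                        ≡⟨ ∑ℕ≡sum (suc n) f ⟩
  Sum.sum f                           ≡⟨ Sum.sum-remove f ⟩
  f i + Sum.sum (f ∘ punchIn i)       ≡⟨ cong (f i +_) (∑ℕ≡sum n (f ∘ punchIn i)) ⟨
  f i + ∑ℕ n (f ∘ punchIn i)          ∎
  where open ≡-Reasoning

-- By induction on `m`: take out `ν zero` and pull the other values back along `punchOut`. Thus `μ`
-- enumerates the complement of the image of `ν`. The three consequences below bound a sum, restrict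
-- it to the image, and find an element outside the image.
∑ℕ-split : (ν : Fin m → Fin n) → (∀ {x y} → ν x ≡ ν y → x ≡ y) →
  ∃ λ k → Σ (Fin k → Fin n) λ μ → (∀ j x → μ j ≢ ν x) ×
    (∀ f → ∑ℕ n f ≡ ∑ℕ m (f ∘ ν) + ∑ℕ k (f ∘ μ))
∑ℕ-split {zero}  {n}     ν ν-inj = n , id , (λ _ ()) , λ f → refl
∑ℕ-split {suc m} {zero}  ν ν-inj with () ← ν zero
∑ℕ-split {suc m} {suc n} ν ν-inj with ∑ℕ-split ν′ ν′-inj
  where
  ν₀≢ : ∀ x → ν zero ≢ ν (suc x)
  ν₀≢ x eq with () ← ν-inj eq
  ν′ : Fin m → Fin n
  ν′ x = punchOut (ν₀≢ x)
  ν′-inj : ∀ {x y} → ν′ x ≡ ν′ y → x ≡ y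
  ν′-inj eq with refl ← ν-inj (punchOut-injective (ν₀≢ _) (ν₀≢ _) eq) = refl
... | k , μ , μ≢ν′ , ∑-μν′ = k , punchIn (ν zero) ∘ μ , μ≢ν , ∑-μν
  where
  open ≡-Reasoning
  ν₀≢ : ∀ x → ν zero ≢ ν (suc x)
  ν₀≢ x eq with () ← ν-inj eq
  μ≢ν : ∀ j x → punchIn (ν zero) (μ j) ≢ ν x
  μ≢ν j zero    eq = punchInᵢ≢i (ν zero) (μ j) eq
  μ≢ν j (suc x) eq = μ≢ν′ j x (punchIn-injective (ν zero) _ _
    (trans eq (sym (punchIn-punchOut (ν₀≢ x)))))
  ∑-μν : ∀ f → ∑ℕ (suc n) f ≡ ∑ℕ (suc m) (f ∘ ν) + ∑ℕ k (f ∘ punchIn (ν zero) ∘ μ)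
  ∑-μν f = begin
    ∑ℕ (suc n) f
      ≡⟨ ∑ℕ-remove (ν zero) f ⟩
    f (ν zero) + ∑ℕ n (f ∘ punchIn (ν zero))
      ≡⟨ cong (f (ν zero) +_) (∑-μν′ _) ⟩
    f (ν zero) + (∑ℕ m (λ x → f (punchIn (ν zero) (punchOut (ν₀≢ x)))) + _)
      ≡⟨ cong (λ s → f (ν zero) + (s + ∑ℕ k (f ∘ punchIn (ν zero) ∘ μ)))
           (∑ℕ-cong (λ x → cong f (punchIn-punchOut (ν₀≢ x)))) ⟩
    f (ν zero) + (∑ℕ m (f ∘ ν ∘ suc) + _)
      ≡⟨ +-assoc (f (ν zero)) _ _ ⟨
    ∑ℕ (suc m) (f ∘ ν) + ∑ℕ k (f ∘ punchIn (ν zero) ∘ μ) ∎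

∑ℕ-injective-≤ : (ν : Fin m → Fin n) → (∀ {x y} → ν x ≡ ν y → x ≡ y) →
  ∀ f → ∑ℕ m (f ∘ ν) ≤ ∑ℕ n f
∑ℕ-injective-≤ ν ν-inj f with _ , _ , _ , ∑-μν ← ∑ℕ-split ν ν-inj =
  subst (_ ≤_) (sym (∑-μν f)) (m≤m+n _ _)

∑ℕ-supported : (ν : Fin m → Fin n) → (∀ {x y} → ν x ≡ ν y → x ≡ y) →
  ∀ f → (∀ w → (∀ x → w ≢ ν x) → f w ≡ 0) → ∑ℕ n f ≡ ∑ℕ m (f ∘ ν)
∑ℕ-supported {m} ν ν-inj f f-off with k , μ , μ≢ν , ∑-μν ← ∑ℕ-split ν ν-inj =
  trans (∑-μν f) (trans (cong (∑ℕ m (f ∘ ν) +_) (∑ℕ-zero (λ j → f-off (μ j) (μ≢ν j)))) (+-identityʳ _))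

∑ℕ-outside : (ν : Fin m → Fin n) → (∀ {x y} → ν x ≡ ν y → x ≡ y) →
  ∀ f → ∑ℕ m (f ∘ ν) < ∑ℕ n f → ∃ λ w → (∀ x → w ≢ ν x) × 0 < f w
∑ℕ-outside {m} ν ν-inj f ∑<∑ with k , μ , μ≢ν , ∑-μν ← ∑ℕ-split ν ν-inj
  with j , 0<fj ← ∑ℕ-positive k (f ∘ μ) (+-cancelˡ-< (∑ℕ m (f ∘ ν)) 0 _
         (subst₂ _<_ (sym (+-identityʳ _)) (∑-μν f) ∑<∑))
  = μ j , μ≢ν j , 0<fj

-- Signed summands become natural numbers once `g` is added termwise. For net-degrees `g` marks the
-- negative edges, for entries of A² it marks the edges at the first vertex.
∑ℤ-lift : ∀ n (F : Fin n → ℤ) (g h : Fin n → ℕ) → (∀ k → F k ℤ.+ ⁺ g k ≡ ⁺ h k) →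
  ∑ℤ n F ℤ.+ ⁺ ∑ℕ n g ≡ ⁺ ∑ℕ n h
∑ℤ-lift zero    F g h eq = refl
∑ℤ-lift (suc n) F g h eq = begin
  (F zero ℤ.+ ∑ℤ n (F ∘ suc)) ℤ.+ (⁺ g zero ℤ.+ ⁺ ∑ℕ n (g ∘ suc))
    ≡⟨ interchange (F zero) (∑ℤ n (F ∘ suc)) (⁺ g zero) (⁺ ∑ℕ n (g ∘ suc)) ⟩
  (F zero ℤ.+ ⁺ g zero) ℤ.+ (∑ℤ n (F ∘ suc) ℤ.+ ⁺ ∑ℕ n (g ∘ suc))
    ≡⟨ cong₂ ℤ._+_ (eq zero) (∑ℤ-lift n (F ∘ suc) (g ∘ suc) (h ∘ suc) (eq ∘ suc)) ⟩
  ⁺ ∑ℕ (suc n) h ∎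
  where
  open ≡-Reasoning
  open import Algebra.Properties.CommutativeSemigroup ℤ.+-commutativeSemigroup using (interchange)

-- Entries of A²

ind : EdgeSign → EdgeSign → ℕ
ind pos  pos  = 1
ind neg  neg  = 1
ind none none = 1
ind _    _    = 0

ind-positive : ∀ e e′ → 0 < ind e e′ → e′ ≡ e
ind-positive pos  pos  _ = refl
ind-positive neg  neg  _ = refl
ind-positive none none _ = refl

∑ℕ-by-sign : ∀ n (f : Fin n → EdgeSign) (h : EdgeSign → ℕ) →
  ∑ℕ n (h ∘ f) ≡ ∑ℕ n (ind pos ∘ f) * h pos + ∑ℕ n (ind neg ∘ f) * h neg + ∑ℕ n (ind none ∘ f) * h none
∑ℕ-by-sign zero    f h = refl
∑ℕ-by-sign (suc n) f h rewrite ∑ℕ-by-sign n (f ∘ suc) h with f zero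
... | pos  = solve 6 (λ x y z p q r → x :+ (p :* x :+ q :* y :+ r :* z) := (con 1 :+ p) :* x :+ q :* y :+ r :* z)
  refl (h pos) (h neg) (h none) (∑ℕ n (ind pos ∘ f ∘ suc)) (∑ℕ n (ind neg ∘ f ∘ suc)) (∑ℕ n (ind none ∘ f ∘ suc))
  where open +-*-Solver
... | neg  = solve 6 (λ x y z p q r → y :+ (p :* x :+ q :* y :+ r :* z) := p :* x :+ (con 1 :+ q) :* y :+ r :* z)
  refl (h pos) (h neg) (h none) (∑ℕ n (ind pos ∘ f ∘ suc)) (∑ℕ n (ind neg ∘ f ∘ suc)) (∑ℕ n (ind none ∘ f ∘ suc))
  where open +-*-Solver
... | none = solve 6 (λ x y z p q r → z :+ (p :* x :+ q :* y :+ r :* z) := p :* x :+ q :* y :+ (con 1 :+ r) :* z)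
  refl (h pos) (h neg) (h none) (∑ℕ n (ind pos ∘ f ∘ suc)) (∑ℕ n (ind neg ∘ f ∘ suc)) (∑ℕ n (ind none ∘ f ∘ suc))
  where open +-*-Solver

countOf : RawSG n → EdgeSign → Fin n → ℕ
countOf {n} σ e v = ∑ℕ n (λ k → ind e (σ v k))

-- The product of two adjacency entries, raised by one when the first is an edge: at a vertex i of
-- degree 5 the sum of these over all k is (A²)ᵢⱼ + 5, so that no negative numbers occur.
walk : EdgeSign → EdgeSign → ℕ
walk none _    = 0
walk _    none = 1
walk pos  pos  = 2
walk neg  neg  = 2
walk _    _    = 0

walks : RawSG n → Fin n → Fin n → ℕ
walks {n} σ i j = ∑ℕ n (λ k → walk (σ i k) (σ j k))

-- t e is the prescribed value of (A²)ᵢⱼ + 5 when the pair i, j has sign e.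
record Admissible {n} (σ : RawSG n) (t : EdgeSign → ℕ) : Set where
  field
    symmetric : ∀ i j → σ i j ≡ σ j i
    loopless  : ∀ i → σ i i ≡ none
    connected : Connected σ
    pos-count : ∀ v → countOf σ pos v ≡ 3
    neg-count : ∀ v → countOf σ neg v ≡ 2
    walks-off : ∀ i j → i ≢ j → walks σ i j ≡ t (σ i j)

-- The search

Cell : Set
Cell = Maybe EdgeSign

Row : ℕ → Set
Row m = Vec Cell m

Table : ℕ → Set
Table m = Vec (Row m) m

hits : EdgeSign → Cell → ℕ
hits e nothing   = 0
hits e (just e′) = ind e e′

tally : EdgeSign → Row m → ℕ
tally e []      = 0
tally e (c ∷ r) = hits e c + tally e r

complete : Row m → Bool
complete []            = true
complete (nothing ∷ r) = false
complete (just _ ∷ r)  = complete r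

saturated : Row m → Bool
saturated r = (tally pos r ≡ᵇ 3) ∧ (tally neg r ≡ᵇ 2)

done : Row m → Bool
done r = complete r ∧ saturated r

withinDegrees : Row m → Bool
withinDegrees r = (tally pos r ≤ᵇ 3) ∧ (tally neg r ≤ᵇ 2)

-- Bounds for `walk` over all fillings of unknown cells: 0 and 2 are its extreme values, and a first
-- sign `none` forces 0.
lo hi : Cell → Cell → ℕ
lo (just e)    (just e′) = walk e e′
lo _           _         = 0
hi (just e)    (just e′) = walk e e′
hi (just none) nothing   = 0
hi _           _         = 2

loSum hiSum : Row m → Row m → ℕ
loSum []      []        = 0
loSum (c ∷ r) (c′ ∷ r′) = lo c c′ + loSum r r′
hiSum []      []        = 0
hiSum (c ∷ r) (c′ ∷ r′) = hi c c′ + hiSum r r′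

allRows : ∀ {A : Set} → Vec A k → (Fin k → A → Bool) → Bool
allRows []       p = true
allRows (r ∷ rs) p = p zero r ∧ allRows rs (λ i → p (suc i))

later : Maybe (Fin m) → Bool → Maybe (Fin (suc m))
later (just i) _     = just (suc i)
later nothing  true  = just zero
later nothing  false = nothing

-- The last index belongs to the oldest vertex, so the search works on the oldest unfinished row
-- first.
lastWhere : ∀ {A : Set} → (A → Bool) → Vec A m → Maybe (Fin m)
lastWhere p []       = nothing
lastWhere p (x ∷ xs) = later (lastWhere p xs) (p x)

isUnknown : Cell → Bool
isUnknown nothing  = true
isUnknown (just _) = false

assign : Table m → Fin m → Fin m → EdgeSign → Table m
assign R i j e = (R [ i ]%= (_[ j ]≔ just e)) [ j ]%= (_[ i ]≔ just e)

-- A new vertex is not adjacent to a done one, all of whose neighbours are in the table already.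
blank : Row m → Cell
blank r = if done r then just none else nothing

-- The new vertex gets index zero and the others are shifted, so the oldest vertex has the largest index.
extend : Table m → Fin m → EdgeSign → Table (suc m)
extend R i e = (just none ∷ new) ∷ zipWith _∷_ new R
  where new = map blank R [ i ]≔ just e

_≟ₛ_ : DecidableEquality EdgeSign
pos  ≟ₛ pos  = yes refl
pos  ≟ₛ neg  = no λ ()
pos  ≟ₛ none = no λ ()
neg  ≟ₛ pos  = no λ ()
neg  ≟ₛ neg  = yes refl
neg  ≟ₛ none = no λ ()
none ≟ₛ pos  = no λ ()
none ≟ₛ neg  = no λ ()
none ≟ₛ none = yes refl

_≟ᶜ_ : DecidableEquality Cell
_≟ᶜ_ = Maybe.≡-dec _≟ₛ_

-- Backtracking that need not be correct: a copy that it finds is verified by isCopy?.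
partialCopies : RawSG k → Table m → List (Vec (Fin m) k)
partialCopies {zero}          τ R = [] ∷ []
partialCopies {suc k} {m = m} τ R = concatMap
  (λ g → List.map (_∷ g) (filterᵇ (λ x → allRows g (λ j y →
     does (lookup (lookup R x) y ≟ᶜ just (τ zero (suc j))))) (allFin m)))
  (partialCopies (λ i j → τ (suc i) (suc j)) R)

IsCopy : RawSG k → Table m → Vec (Fin m) k → Set
IsCopy τ R g =
  (∀ i j → lookup (lookup R (lookup g i)) (lookup g j) ≡ just (τ i j)) ×
  (∀ x → ∃ λ i → lookup g i ≡ x) ×
  (∀ i j → lookup g i ≡ lookup g j → i ≡ j)

isCopy? : (τ : RawSG k) (R : Table m) (g : Vec (Fin m) k) → Dec (IsCopy τ R g)
isCopy? τ R g =
  all? (λ i → all? (λ j → lookup (lookup R (lookup g i)) (lookup g j) ≟ᶜ just (τ i j))) ×-dec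
  all? (λ x → any? (λ i → lookup g i ≟ x)) ×-dec
  all? (λ i → all? (λ j → (lookup g i ≟ lookup g j) →-dec (i ≟ j)))

copyOf : RawSG k → Table m → Bool
copyOf τ R = maybe (λ g → isYes (isCopy? τ R g)) false (head (partialCopies τ R))

module _ (t : EdgeSign → ℕ) where

  -- The first argument says whether both rows belong to the same vertex, where t prescribes nothing.
  consistent : Bool → Cell → Row m → Row m → Bool
  consistent false (just e) r r′ = (loSum r r′ ≤ᵇ t e) ∧ (t e ≤ᵇ hiSum r r′)
  consistent _     _        r r′ = true

  -- A row is compared with others only when it is done: then its vertex has all its neighbours in
  -- the table, and the whole entry of A² is visible there. The test is confined to pairs that
  -- contain `i` or `j`, the rows where the newest sign stands.
  viableRows : Table m → Fin m → Fin m → Row m → Row m → Bool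
  viableRows R i j rᵢ rⱼ =
    withinDegrees rᵢ ∧ withinDegrees rⱼ ∧
    allRows R (λ x r → if done r
      then consistent (does (x ≟ i)) (lookup r i) r rᵢ ∧ consistent (does (x ≟ j)) (lookup r j) r rⱼ
      else true) ∧
    (if done rᵢ then allRows R (λ y r → consistent (does (i ≟ y)) (lookup rᵢ y) rᵢ r) else true)

  viable : Table m → Fin m → Fin m → Bool
  viable R i j = viableRows R i j (lookup R i) (lookup R j)

  search : ℕ → Table m → Bool
  tryAssign : ℕ → Table m → Fin m → Fin m → EdgeSign → Bool
  tryExtend : ℕ → Table m → Fin m → EdgeSign → Bool

  -- Running out of fuel counts as failure, so `true` certifies that the whole tree has been
  -- explored.
  search zero       R = false
  search (suc fuel) R with lastWhere (not ∘ done) R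
  ... | nothing = copyOf G₂ R ∨ copyOf S₁₂ R
  ... | just i  with lastWhere isUnknown (lookup R i)
  ...   | just j  = tryAssign fuel R i j pos ∧ tryAssign fuel R i j neg ∧ tryAssign fuel R i j none
  -- A complete row within the degree bounds that is not done lacks a positive or a negative
  -- neighbour. That neighbour must exist, so no case split on its sign is made; the final `false`
  -- is a failing default.
  ...   | nothing =
    if tally pos (lookup R i) <ᵇ 3 then tryExtend fuel R i pos else
    if tally neg (lookup R i) <ᵇ 2 then tryExtend fuel R i neg else false

  tryAssign fuel R i j e = if viable (assign R i j e) i j then search fuel (assign R i j e) else true
  tryExtend fuel R i e = if viable (extend R i e) (suc i) zero then search fuel (extend R i e) else true

start : Table 1
start = (just none ∷ []) ∷ []

target : ℕ → ℕ → ℕ → EdgeSign → ℕ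
target α β γ pos  = α
target α β γ neg  = β
target α β γ none = γ

-- Soundness of the search

data _⊑_ : Cell → EdgeSign → Set where
  unknown : ∀ {e} → nothing ⊑ e
  known   : ∀ {e} → just e ⊑ e

known-≡ : ∀ {e e′} → just e ⊑ e′ → e′ ≡ e
known-≡ known = refl

Agrees : Row m → (Fin m → EdgeSign) → Set
Agrees r f = ∀ x → lookup r x ⊑ f x

tally-≤ : ∀ e (r : Row m) {f} → Agrees r f → tally e r ≤ ∑ℕ m (ind e ∘ f)
tally-≤ e []      r⊑f = z≤n
tally-≤ e (c ∷ r) r⊑f = +-mono-≤ (hits-≤ (r⊑f zero)) (tally-≤ e r (r⊑f ∘ suc))
  where
  hits-≤ : ∀ {c e′} → c ⊑ e′ → hits e c ≤ ind e e′
  hits-≤ unknown = z≤n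
  hits-≤ known   = ≤-refl

tally-≡ : ∀ e (r : Row m) {f} → Agrees r f → (∀ x → isUnknown (lookup r x) ≡ false) →
  tally e r ≡ ∑ℕ m (ind e ∘ f)
tally-≡ e []      r⊑f full = refl
tally-≡ e (c ∷ r) r⊑f full = cong₂ _+_ (hits-≡ (r⊑f zero) (full zero)) (tally-≡ e r (r⊑f ∘ suc) (full ∘ suc))
  where
  hits-≡ : ∀ {c e′} → c ⊑ e′ → isUnknown c ≡ false → hits e c ≡ ind e e′
  hits-≡ known _ = refl

walk-≤2 : ∀ e e′ → walk e e′ ≤ 2
walk-≤2 pos  pos  = ≤-refl
walk-≤2 pos  neg  = z≤n
walk-≤2 pos  none = s≤s z≤n
walk-≤2 neg  pos  = z≤n
walk-≤2 neg  neg  = ≤-refl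
walk-≤2 neg  none = s≤s z≤n
walk-≤2 none e′   = z≤n

loSum-≤ : ∀ (r r′ : Row m) {f f′} → Agrees r f → Agrees r′ f′ →
  loSum r r′ ≤ ∑ℕ m (λ x → walk (f x) (f′ x))
loSum-≤ []      []        r⊑f r′⊑f′ = z≤n
loSum-≤ (_ ∷ r) (_ ∷ r′) r⊑f r′⊑f′ =
  +-mono-≤ (lo-≤ (r⊑f zero) (r′⊑f′ zero)) (loSum-≤ r r′ (r⊑f ∘ suc) (r′⊑f′ ∘ suc))
  where
  lo-≤ : ∀ {c c′ e e′} → c ⊑ e → c′ ⊑ e′ → lo c c′ ≤ walk e e′
  lo-≤ unknown _       = z≤n
  lo-≤ known   unknown = z≤n
  lo-≤ known   known   = ≤-refl

hiSum-≥ : ∀ (r r′ : Row m) {f f′} → Agrees r f → Agrees r′ f′ →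
  ∑ℕ m (λ x → walk (f x) (f′ x)) ≤ hiSum r r′
hiSum-≥ []      []        r⊑f r′⊑f′ = z≤n
hiSum-≥ (_ ∷ r) (_ ∷ r′) r⊑f r′⊑f′ =
  +-mono-≤ (hi-≥ (r⊑f zero) (r′⊑f′ zero)) (hiSum-≥ r r′ (r⊑f ∘ suc) (r′⊑f′ ∘ suc))
  where
  hi-≥ : ∀ {c c′ e e′} → c ⊑ e → c′ ⊑ e′ → walk e e′ ≤ hi c c′
  hi-≥ {e = e} {e′} unknown _ = walk-≤2 e e′
  hi-≥ {e = pos}  {e′} known unknown = walk-≤2 pos e′
  hi-≥ {e = neg}  {e′} known unknown = walk-≤2 neg e′
  hi-≥ {e = none} known unknown = z≤n
  hi-≥ known known = ≤-refl

∧⁺ : ∀ b c → T b → T c → T (b ∧ c)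
∧⁺ true true _ _ = tt

∧⁻ : ∀ b {c} → T (b ∧ c) → T b × T c
∧⁻ true p = tt , p

allRows-complete : ∀ {A : Set} (R : Vec A k) {p} → (∀ x → T (p x (lookup R x))) → T (allRows R p)
allRows-complete []      p-all = tt
allRows-complete (r ∷ R) p-all = ∧⁺ _ _ (p-all zero) (allRows-complete R (p-all ∘ suc))

lastWhere-nothing : ∀ {A : Set} (p : A → Bool) (v : Vec A m) → lastWhere p v ≡ nothing →
  ∀ x → p (lookup v x) ≡ false
lastWhere-nothing p (a ∷ v) eq x with lastWhere p v in eq′ | p a in pa
lastWhere-nothing p (a ∷ v) eq zero    | nothing | false = pa
lastWhere-nothing p (a ∷ v) eq (suc x) | nothing | false = lastWhere-nothing p v eq′ x

-- Letting `P` depend on the position makes this serve both for cells of a row and for rows of a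
-- table.
update-pointwise : ∀ {A : Set} (P : Fin m → A → Set) (v : Vec A m) i {f : A → A} →
  (P i (lookup v i) → P i (f (lookup v i))) →
  (∀ x → P x (lookup v x)) → ∀ x → P x (lookup (v [ i ]%= f) x)
update-pointwise P (a ∷ v) zero    Pf Pv zero    = Pf (Pv zero)
update-pointwise P (a ∷ v) zero    Pf Pv (suc x) = Pv (suc x)
update-pointwise P (a ∷ v) (suc i) Pf Pv zero    = Pv zero
update-pointwise P (a ∷ v) (suc i) Pf Pv (suc x) = update-pointwise (P ∘ suc) v i Pf (Pv ∘ suc) x

Agrees-update : ∀ (r : Row m) {f} j {e} → f j ≡ e → Agrees r f → Agrees (r [ j ]≔ just e) f
Agrees-update r {f} j refl = update-pointwise (λ x c → c ⊑ f x) r j (λ _ → known)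

if-T : ∀ {b c} → T (if b then c else true) → T b → T c
if-T {true} c _ = c

if-else-true : ∀ {b c} → (T b → T c) → T (if b then c else true)
if-else-true {true}  f = f tt
if-else-true {false} f = tt

T-not-false : ∀ {b} → not b ≡ false → T b
T-not-false {true} _ = tt

done-tally : ∀ (r : Row m) → T (done r) → tally pos r ≡ 3 × tally neg r ≡ 2
done-tally r d with p , q ← ∧⁻ (tally pos r ≡ᵇ 3) (proj₂ (∧⁻ (complete r) d)) =
  ≡ᵇ⇒≡ (tally pos r) 3 p , ≡ᵇ⇒≡ (tally neg r) 2 q

-- Tables realised in a signed graph

record Realises {n} (σ : RawSG n) (R : Table m) (ν : Fin m → Fin n) : Set where
  field
    origin    : Fin m
    injective : ∀ {x y} → ν x ≡ ν y → x ≡ y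
    agrees    : ∀ x → Agrees (lookup R x) (λ y → σ (ν x) (ν y))

name : Fin n → (Fin m → Fin n) → Fin (suc m) → Fin n
name w ν zero    = w
name w ν (suc x) = ν x

name-injective : ∀ {w} {ν : Fin m → Fin n} → (∀ x → w ≢ ν x) → (∀ {x y} → ν x ≡ ν y → x ≡ y) →
  ∀ {x y} → name w ν x ≡ name w ν y → x ≡ y
name-injective w≢ν ν-inj {zero}  {zero}  eq = refl
name-injective w≢ν ν-inj {zero}  {suc y} eq = contradiction eq (w≢ν y)
name-injective w≢ν ν-inj {suc x} {zero}  eq = contradiction (sym eq) (w≢ν x)
name-injective w≢ν ν-inj {suc x} {suc y} eq = cong suc (ν-inj eq)

module _ {n} {σ : RawSG n} {t : EdgeSign → ℕ} (σ-ok : Admissible σ t) where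
  open Admissible σ-ok

  module _ {m} {R : Table m} {ν : Fin m → Fin n} (R-ok : Realises σ R ν) where
    open Realises R-ok

    tally-≤-count : ∀ e x → tally e (lookup R x) ≤ countOf σ e (ν x)
    tally-≤-count e x = ≤-trans (tally-≤ e (lookup R x) (agrees x)) (∑ℕ-injective-≤ ν injective (ind e ∘ σ (ν x)))

    -- Otherwise `w` could be appended to the naming as one more vertex, and the signs `e` at `ν x`
    -- would outnumber `countOf`.
    exhausted : ∀ e x → tally e (lookup R x) ≡ countOf σ e (ν x) →
      ∀ w → (∀ y → w ≢ ν y) → σ (ν x) w ≢ e
    exhausted e x full w w≢ν refl = <-irrefl full $ begin-strict
      tally e (lookup R x)               <⟨ n<1+n _ ⟩
      suc (tally e (lookup R x))         ≤⟨ s≤s (tally-≤ e (lookup R x) (agrees x)) ⟩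
      suc (∑ℕ m (ind e ∘ σ (ν x) ∘ ν))   ≡⟨ cong (_+ ∑ℕ m (ind e ∘ σ (ν x) ∘ ν)) (sym (ind-refl e)) ⟩
      ∑ℕ (suc m) (ind e ∘ σ (ν x) ∘ name w ν)
        ≤⟨ ∑ℕ-injective-≤ (name w ν) (name-injective w≢ν injective) (ind e ∘ σ (ν x)) ⟩
      countOf σ e (ν x)                  ∎
      where
      open ≤-Reasoning
      ind-refl : ∀ e → ind e e ≡ 1
      ind-refl pos  = refl
      ind-refl neg  = refl
      ind-refl none = refl

    -- A done row already shows three positive and two negative neighbours, which are all that `ν x`
    -- has.
    done-closed : ∀ x → T (done (lookup R x)) → ∀ w → (∀ y → w ≢ ν y) → σ (ν x) w ≡ none
    done-closed x d w w≢ν with p , q ← done-tally (lookup R x) d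
      with σ (ν x) w in eq
    ... | pos  = contradiction eq (exhausted pos x (trans p (sym (pos-count (ν x)))) w w≢ν)
    ... | neg  = contradiction eq (exhausted neg x (trans q (sym (neg-count (ν x)))) w w≢ν)
    ... | none = refl

    -- Vertices outside the table contribute nothing, since they are not adjacent to `ν x` and
    -- `walk none` vanishes.
    done-walks : ∀ x y → T (done (lookup R x)) →
      walks σ (ν x) (ν y) ≡ ∑ℕ m (λ z → walk (σ (ν x) (ν z)) (σ (ν y) (ν z)))
    done-walks x y d = ∑ℕ-supported ν injective _
      (λ w w≢ν → cong (λ e → walk e (σ (ν y) w)) (done-closed x d w w≢ν))

    done-consistent : ∀ x y → T (done (lookup R x)) →
      T (consistent t (does (x ≟ y)) (lookup (lookup R x) y) (lookup R x) (lookup R y))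
    done-consistent x y d with x ≟ y | lookup (lookup R x) y | agrees x y
    ... | yes _  | _       | _     = tt
    ... | no _   | nothing | _     = tt
    ... | no x≢y | just _  | known = ∧⁺ _ _
      (≤⇒≤ᵇ (subst (loSum (lookup R x) (lookup R y) ≤_) value (loSum-≤ (lookup R x) (lookup R y) (agrees x) (agrees y))))
      (≤⇒≤ᵇ (subst (_≤ hiSum (lookup R x) (lookup R y)) value (hiSum-≥ (lookup R x) (lookup R y) (agrees x) (agrees y))))
      where
      value : ∑ℕ m (λ z → walk (σ (ν x) (ν z)) (σ (ν y) (ν z))) ≡ t (σ (ν x) (ν y))
      value = trans (sym (done-walks x y d)) (walks-off (ν x) (ν y) (x≢y ∘ injective))

    -- Read contrapositively, this justifies pruning: a table rejected by `viable` describes no part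
    -- of `σ`.
    realises-viable : ∀ i j → T (viable t R i j)
    realises-viable i j =
      ∧⁺ (withinDegrees (lookup R i)) _ (light i) $
      ∧⁺ (withinDegrees (lookup R j)) _ (light j) $
      ∧⁺ (allRows R _) _
        (allRows-complete R λ x → if-else-true {done (lookup R x)} λ d →
          ∧⁺ _ _ (done-consistent x i d) (done-consistent x j d))
        (if-else-true {done (lookup R i)} λ d → allRows-complete R λ y → done-consistent i y d)
      where
      light : ∀ x → T (withinDegrees (lookup R x))
      light x = ∧⁺ (tally pos (lookup R x) ≤ᵇ 3) _
        (≤⇒≤ᵇ (subst (tally pos (lookup R x) ≤_) (pos-count (ν x)) (tally-≤-count pos x)))
        (≤⇒≤ᵇ (subst (tally neg (lookup R x) ≤_) (neg-count (ν x)) (tally-≤-count neg x)))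

    realises-assign : ∀ i j → Realises σ (assign R i j (σ (ν i) (ν j))) ν
    realises-assign i j = record
      { origin    = origin
      ; injective = injective
      ; agrees    = update-pointwise Fits R′ j (Agrees-update (lookup R′ j) i (symmetric (ν j) (ν i)))
          (update-pointwise Fits R i (Agrees-update (lookup R i) j refl) agrees)
      }
      where
      Fits : Fin m → Row m → Set
      Fits x r = Agrees r (σ (ν x) ∘ ν)
      R′ = R [ i ]%= (_[ j ]≔ just (σ (ν i) (ν j)))

    realises-extend : ∀ i w → (∀ y → w ≢ ν y) → Realises σ (extend R i (σ (ν i) w)) (name w ν)
    realises-extend i w w≢ν = record
      { origin    = zero
      ; injective = name-injective w≢ν injective
      ; agrees    = agrees′
      }
      where
      new : Row m
      new = map blank R [ i ]≔ just (σ (ν i) w)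
      blank-⊑ : ∀ x → lookup (map blank R) x ⊑ σ w (ν x)
      blank-⊑ x rewrite lookup-map x blank R with done (lookup R x) in d
      ... | false = unknown
      ... | true  rewrite trans (symmetric w (ν x)) (done-closed x (subst T (sym d) tt) w w≢ν) = known
      new-⊑ : ∀ x → lookup new x ⊑ σ w (ν x)
      new-⊑ = Agrees-update (map blank R) i (symmetric w (ν i)) blank-⊑
      agrees′ : ∀ x → Agrees (lookup (extend R i (σ (ν i) w)) x) (λ y → σ (name w ν x) (name w ν y))
      agrees′ zero    zero    rewrite loopless w = known
      agrees′ zero    (suc y) = new-⊑ y
      agrees′ (suc x) y = subst (λ r → lookup r y ⊑ σ (ν x) (name w ν y)) (sym (lookup-zipWith _∷_ x new R)) (row y)
        where
        row : Agrees (lookup new x ∷ lookup R x) (σ (ν x) ∘ name w ν)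
        row zero    = subst (lookup new x ⊑_) (symmetric w (ν x)) (new-⊑ x)
        row (suc y) = agrees x y

    -- In a fully known row the tally is the exact count among named vertices, so any shortfall must
    -- be made up by a vertex outside the table.
    unnamed : ∀ e i → (∀ y → isUnknown (lookup (lookup R i) y) ≡ false) →
      tally e (lookup R i) < countOf σ e (ν i) → ∃ λ w → (∀ y → w ≢ ν y) × σ (ν i) w ≡ e
    unnamed e i full short with w , w≢ν , 0<ind ← ∑ℕ-outside ν injective (ind e ∘ σ (ν i))
        (subst (_< countOf σ e (ν i)) (tally-≡ e (lookup R i) (agrees i) full) short) =
      w , w≢ν , ind-positive e _ 0<ind

    -- When all rows are done, no edge leads from a named vertex to an unnamed one. Hence every path
    -- from `ν origin` stays among the named vertices, and connectedness reaches all of them.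
    all-named : (∀ x → T (done (lookup R x))) → ∀ w → ∃ λ x → ν x ≡ w
    all-named closed w = reached (connected (ν origin) w)
      where
      reached : ∀ {w} → Reach σ (ν origin) w → ∃ λ x → ν x ≡ w
      reached here = origin , refl
      reached (step {k = w} path edge) with x , refl ← reached path with any? (λ y → ν y ≟ w)
      ... | yes named  = named
      ... | no  absent = contradiction (done-closed x (closed x) w (λ y w≡νy → absent (y , sym w≡νy))) edge

    -- Both `ν` and the verified copy `g` are bijections here, and their composite carries the signs
    -- of `τ` to those of `σ`.
    copy-iso : (∀ x → T (done (lookup R x))) → ∀ {k} (τ : RawSG k) → T (copyOf τ R) → Iso σ τ
    copy-iso closed {k} τ found with head (partialCopies τ R)
    ... | just g with edges , onto , one-to-one ← toWitness {a? = isCopy? τ R g} found =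
      mk↔ₛ′ to from to∘from from∘to , preserves
      where
      from : Fin k → Fin n
      from i = ν (lookup g i)
      to : Fin n → Fin k
      to w = proj₁ (onto (proj₁ (all-named closed w)))
      from∘to : ∀ w → from (to w) ≡ w
      from∘to w = trans (cong ν (proj₂ (onto _))) (proj₂ (all-named closed w))
      to∘from : ∀ i → to (from i) ≡ i
      to∘from i = one-to-one _ _ (injective (from∘to (from i)))
      edge : ∀ i j → σ (from i) (from j) ≡ τ i j
      edge i j = known-≡ (subst (_⊑ _) (edges i j) (agrees (lookup g i) (lookup g j)))
      preserves : ∀ v w → σ v w ≡ τ (to v) (to w)
      preserves v w = trans (sym (cong₂ σ (from∘to v) (from∘to w))) (edge (to v) (to w))

  -- The signed graph guides the search: at an unknown entry it follows the branch of the actual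
  -- sign, and for a missing neighbour it names an actual one. Tables on this route are realised, so
  -- `viable` never stops it, and it can end only in a closed table that is a copy.
  search-sound : ∀ fuel {m} (R : Table m) {ν : Fin m → Fin n} → Realises σ R ν →
    T (search t fuel R) → Iso σ G₂ ⊎ Iso σ S₁₂

  extend-sound : ∀ fuel {m} (R : Table m) {ν : Fin m → Fin n} → Realises σ R ν →
    ∀ e i → lastWhere isUnknown (lookup R i) ≡ nothing → tally e (lookup R i) < countOf σ e (ν i) →
    T (tryExtend t fuel R i e) → Iso σ G₂ ⊎ Iso σ S₁₂
  extend-sound fuel R {ν} R-ok e i full short found
    with w , w≢ν , refl ← unnamed R-ok e i (lastWhere-nothing isUnknown (lookup R i) full) short =
    search-sound fuel _ R′-ok
      (if-T {viable t (extend R i (σ (ν i) w)) (suc i) zero} found (realises-viable R′-ok (suc i) zero))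
    where R′-ok = realises-extend R-ok i w w≢ν

  search-sound (suc fuel) R {ν} R-ok found with lastWhere (not ∘ done) R in all-done
  ... | nothing = ⊎.map (copy-iso R-ok closed G₂) (copy-iso R-ok closed S₁₂)
                    (Equivalence.to (T-∨ {copyOf G₂ R}) found)
    where
    closed : ∀ x → T (done (lookup R x))
    closed x = T-not-false (lastWhere-nothing (not ∘ done) R all-done x)
  ... | just i with lastWhere isUnknown (lookup R i) in full
  ...   | just j = search-sound fuel _ R′-ok
    (if-T {viable t (assign R i j (σ (ν i) (ν j))) i j} (branch (σ (ν i) (ν j))) (realises-viable R′-ok i j))
    where
    R′-ok : Realises σ (assign R i j (σ (ν i) (ν j))) ν
    R′-ok = realises-assign R-ok i j
    branch : ∀ e → T (tryAssign t fuel R i j e)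
    branch pos  = proj₁ (∧⁻ (tryAssign t fuel R i j pos) found)
    branch neg  = proj₁ (∧⁻ (tryAssign t fuel R i j neg) (proj₂ (∧⁻ (tryAssign t fuel R i j pos) found)))
    branch none = proj₂ (∧⁻ (tryAssign t fuel R i j neg) (proj₂ (∧⁻ (tryAssign t fuel R i j pos) found)))
  ...   | nothing with tally pos (lookup R i) <ᵇ 3 in p | tally neg (lookup R i) <ᵇ 2 in q
  ...     | true  | _    = extend-sound fuel R R-ok pos i full
    (subst (tally pos (lookup R i) <_) (sym (pos-count (ν i))) (<ᵇ⇒< (tally pos (lookup R i)) 3 (subst T (sym p) tt))) found
  ...     | false | true = extend-sound fuel R R-ok neg i full
    (subst (tally neg (lookup R i) <_) (sym (neg-count (ν i))) (<ᵇ⇒< (tally neg (lookup R i)) 2 (subst T (sym q) tt))) found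

-- The classification

-- α, β, γ are a + 5, b + 5, c + 5; the equation for m is 5 + 3a + 2b + mc = 1.
abstract
  settled : ∀ {α} → α < 11 → ∀ {β} → β < 11 → ∀ {γ} → γ < 11 →
    ∃ (λ m → m < 30 × 3 * α + 2 * β + m * γ ≡ 21 + 5 * m) → T (search (target α β γ) 300 start)
  settled = toWitness {a? =
    allUpTo? (λ α → allUpTo? (λ β → allUpTo? (λ γ →
      anyUpTo? (λ m → 3 * α + 2 * β + m * γ ℕ.≟ 21 + 5 * m) 30 →-dec
      T? (search (target α β γ) 300 start)) 11) 11) 11} _

-- Unless γ = 5, i.e. c = 0, the parameter equation bounds m.
small-multiplicity : ∀ {α β} γ m → α < 11 → β < 11 → 3 * α + 2 * β + m * γ ≡ 21 + 5 * m →
  ∃ λ m → m < 30 × 3 * α + 2 * β + m * γ ≡ 21 + 5 * m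
small-multiplicity {α} {β} γ m α<11 β<11 eq with m <? 30
... | yes m<30 = m , m<30 , eq
... | no  m≮30 with <-cmp γ 5
-- Here the terms in `m` cancel, so the equation also holds with multiplicity 0.
...   | tri≈ _ refl _ = 0 , s≤s z≤n , trans (+-identityʳ _) (+-cancelʳ-≡ (5 * m) _ _
          (trans (cong ((3 * α + 2 * β) +_) (*-comm 5 m)) eq))
-- Since α and β are at most 10, the left side is at most 50 + 4m, which is below 21 + 5m exactly
-- from m = 30 on; this fixes the bound 30.
...   | tri< (s≤s γ≤4) _ _ = contradiction (≤-reflexive (sym eq)) (<⇒≱ (begin-strict
          3 * α + 2 * β + m * γ   ≤⟨ +-mono-≤ (+-mono-≤ (*-monoʳ-≤ 3 (≤-pred α<11)) (*-monoʳ-≤ 2 (≤-pred β<11)))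
                                                (*-monoʳ-≤ m γ≤4) ⟩
          50 + m * 4              <⟨ +-monoˡ-< (m * 4) (+-monoʳ-≤ 21 (≮⇒≥ m≮30)) ⟩
          21 + m + m * 4          ≡⟨ solve 1 (λ m → con 21 :+ m :+ m :* con 4 := con 21 :+ con 5 :* m) refl m ⟩
          21 + 5 * m              ∎))
  where
  open ≤-Reasoning
  open +-*-Solver
-- Already `m * 6` exceeds the right side as soon as m is at least 22.
...   | tri> _ _ 6≤γ = contradiction (≤-reflexive eq) (<⇒≱ (begin-strict
          21 + 5 * m              <⟨ +-monoˡ-< (5 * m) (≤-trans (m≤n+m 22 8) (≮⇒≥ m≮30)) ⟩
          m + 5 * m               ≡⟨ solve 1 (λ m → m :+ con 5 :* m := m :* con 6) refl m ⟩
          m * 6                   ≤⟨ *-monoʳ-≤ m 6≤γ ⟩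
          m * γ                   ≤⟨ m≤n+m (m * γ) (3 * α + 2 * β) ⟩
          3 * α + 2 * β + m * γ   ∎))
  where
  open ≤-Reasoning
  open +-*-Solver

-- Counting in a 5-regular signed graph of net-degree 1

module NetRegularFive {n} {σ : RawSG n} (σ-sym : ∀ i j → σ i j ≡ σ j i)
  (regular : Regular 5 σ) (net-regular : NetRegular (⁺ 1) σ) where

  -- With p positive and q negative edges, net-degree gives p = q + 1 and degree gives p + q = 5.
  counts : ∀ v → countOf σ pos v ≡ 3 × countOf σ neg v ≡ 2
  counts v = trans (sym net) (cong suc q≡2) , q≡2
    where
    open ≡-Reasoning
    open +-*-Solver
    p q z : ℕ
    p = countOf σ pos v
    q = countOf σ neg v
    z = countOf σ none v
    net : suc q ≡ p
    net = ℤ.+-injective (trans (cong (ℤ._+ ⁺ q) (sym (net-regular v)))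
      (∑ℤ-lift n (adj σ v) (ind neg ∘ σ v) (ind pos ∘ σ v) (λ k → pointwise (σ v k))))
      where
      pointwise : ∀ e → adjEntry e ℤ.+ ⁺ ind neg e ≡ ⁺ ind pos e
      pointwise pos  = refl
      pointwise neg  = refl
      pointwise none = refl
    q≡2 : q ≡ 2
    q≡2 = *-cancelˡ-≡ q 2 2 (suc-injective (begin
      suc (2 * q)                ≡⟨ solve 2 (λ q z → con 1 :+ con 2 :* q :=
                                      (con 1 :+ q) :* con 1 :+ q :* con 1 :+ z :* con 0) refl q z ⟩
      suc q * 1 + q * 1 + z * 0  ≡⟨ cong (λ p → p * 1 + q * 1 + z * 0) net ⟩
      p * 1 + q * 1 + z * 0      ≡⟨ ∑ℕ-by-sign n (σ v) isEdge ⟨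
      degree σ v                 ≡⟨ regular v ⟩
      5                          ∎))

  adj²-walks : ∀ i j → adj² σ i j ℤ.+ ⁺ 5 ≡ ⁺ walks σ i j
  adj²-walks i j = trans (cong (λ d → adj² σ i j ℤ.+ ⁺ d) (sym (regular i)))
    (∑ℤ-lift n _ (isEdge ∘ σ i) (λ k → walk (σ i k) (σ j k))
      (λ k → trans (pointwise (σ i k) (σ k j)) (cong (λ e → ⁺ walk (σ i k) e) (σ-sym k j))))
    where
    pointwise : ∀ e e′ → adjEntry e ℤ.* adjEntry e′ ℤ.+ ⁺ isEdge e ≡ ⁺ walk e e′
    pointwise pos  pos  = refl
    pointwise pos  neg  = refl
    pointwise pos  none = refl
    pointwise neg  pos  = refl
    pointwise neg  neg  = refl
    pointwise neg  none = refl
    pointwise none pos  = refl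
    pointwise none neg  = refl
    pointwise none none = refl

  -- Each of the five edges at `i` contributes at most 2. This confines the shifted parameters to a
  -- finite range.
  walks-≤10 : ∀ i j → walks σ i j < 11
  walks-≤10 i j = s≤s (begin
    walks σ i j                                    ≤⟨ ∑ℕ-mono (λ k → pointwise (σ i k) (σ j k)) ⟩
    ∑ℕ n (λ k → isEdge (σ i k) + isEdge (σ i k))   ≡⟨ ∑ℕ-+ (isEdge ∘ σ i) (isEdge ∘ σ i) ⟩
    degree σ i + degree σ i                        ≡⟨ cong₂ _+_ (regular i) (regular i) ⟩
    10                                             ∎)
    where
    open ≤-Reasoning
    pointwise : ∀ e e′ → walk e e′ ≤ isEdge e + isEdge e
    pointwise none e′ = z≤n
    pointwise pos  e′ = walk-≤2 pos e′
    pointwise neg  e′ = walk-≤2 neg e′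

  walks-diagonal : ∀ v → walks σ v v ≡ 10
  walks-diagonal v = begin
    walks σ v v                                    ≡⟨ ∑ℕ-cong (λ k → pointwise (σ v k)) ⟩
    ∑ℕ n (λ k → isEdge (σ v k) + isEdge (σ v k))   ≡⟨ ∑ℕ-+ (isEdge ∘ σ v) (isEdge ∘ σ v) ⟩
    degree σ v + degree σ v                        ≡⟨ cong₂ _+_ (regular v) (regular v) ⟩
    10                                             ∎
    where
    open ≡-Reasoning
    pointwise : ∀ e → walk e e ≡ isEdge e + isEdge e
    pointwise pos  = refl
    pointwise neg  = refl
    pointwise none = refl

  neighbour : ∀ e v → 0 < countOf σ e v → ∃ λ w → σ v w ≡ e
  neighbour e v 0<count with w , 0<ind ← ∑ℕ-positive n (ind e ∘ σ v) 0<count =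
    w , ind-positive e _ 0<ind

  -- Summed over the endpoint j first, the row sum of A² at v is a sum of row sums of A.
  walks-total : ∀ v → ∑ℕ n (walks σ v) ≡ 3 * (n + 1) + 2 * (n ∸ 1)
  walks-total v = begin
    ∑ℕ n (λ j → ∑ℕ n (λ k → walk (σ v k) (σ j k)))  ≡⟨ ∑ℕ-comm (λ j k → walk (σ v k) (σ j k)) ⟩
    ∑ℕ n (λ k → ∑ℕ n (λ j → walk (σ v k) (σ j k)))  ≡⟨ ∑ℕ-cong (λ k → column (σ v k) k) ⟩
    ∑ℕ n (λ k → through (σ v k))                    ≡⟨ ∑ℕ-by-sign n (σ v) through ⟩
    countOf σ pos v * (n + 1) + countOf σ neg v * (n ∸ 1) + countOf σ none v * 0
      ≡⟨ cong₂ (λ p q → p * (n + 1) + q * (n ∸ 1) + countOf σ none v * 0) (proj₁ (counts v)) (proj₂ (counts v)) ⟩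
    3 * (n + 1) + 2 * (n ∸ 1) + countOf σ none v * 0
      ≡⟨ cong ((3 * (n + 1) + 2 * (n ∸ 1)) +_) (*-zeroʳ (countOf σ none v)) ⟩
    3 * (n + 1) + 2 * (n ∸ 1) + 0                   ≡⟨ +-identityʳ _ ⟩
    3 * (n + 1) + 2 * (n ∸ 1)                       ∎
    where
    open ≡-Reasoning
    -- For an edge to `k` the summands are 1 plus, or for a negative edge 1 minus, the entries of
    -- row `k` of A, and that row sums to 1.
    through : EdgeSign → ℕ
    through pos  = n + 1
    through neg  = n ∸ 1
    through none = 0
    column : ∀ e k → ∑ℕ n (λ j → walk e (σ j k)) ≡ through e
    column e k = trans (∑ℕ-cong (λ j → cong (walk e) (σ-sym j k))) (row e)
      where
      balance : ∀ (f g h : EdgeSign → ℕ) → (∀ e → f e + g e ≡ 1 + h e) →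
        ∑ℕ n (f ∘ σ k) + ∑ℕ n (g ∘ σ k) ≡ n + ∑ℕ n (h ∘ σ k)
      balance f g h eq = begin
        ∑ℕ n (f ∘ σ k) + ∑ℕ n (g ∘ σ k)       ≡⟨ ∑ℕ-+ (f ∘ σ k) (g ∘ σ k) ⟨
        ∑ℕ n (λ j → f (σ k j) + g (σ k j))    ≡⟨ ∑ℕ-cong (λ j → eq (σ k j)) ⟩
        ∑ℕ n (λ j → 1 + h (σ k j))            ≡⟨ ∑ℕ-+ (λ _ → 1) (h ∘ σ k) ⟩
        ∑ℕ n (λ _ → 1) + ∑ℕ n (h ∘ σ k)       ≡⟨ cong (_+ ∑ℕ n (h ∘ σ k)) (trans (∑ℕ-const n 1) (*-identityʳ n)) ⟩
        n + ∑ℕ n (h ∘ σ k)                    ∎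
      row : ∀ e → ∑ℕ n (walk e ∘ σ k) ≡ through e
      row pos  = +-cancelʳ-≡ 2 _ _ (begin
        ∑ℕ n (walk pos ∘ σ k) + 2                  ≡⟨ cong (∑ℕ n (walk pos ∘ σ k) +_) (proj₂ (counts k)) ⟨
        ∑ℕ n (walk pos ∘ σ k) + countOf σ neg k    ≡⟨ balance (walk pos) (ind neg) (ind pos)
                                                       (λ { pos → refl ; neg → refl ; none → refl }) ⟩
        n + countOf σ pos k                        ≡⟨ cong (n +_) (proj₁ (counts k)) ⟩
        n + (1 + 2)                                ≡⟨ +-assoc n 1 2 ⟨
        n + 1 + 2                                  ∎)
      row neg  = begin
        ∑ℕ n (walk neg ∘ σ k)          ≡⟨ m+n∸n≡m _ 3 ⟨
        ∑ℕ n (walk neg ∘ σ k) + 3 ∸ 3  ≡⟨ cong (λ p → ∑ℕ n (walk neg ∘ σ k) + p ∸ 3) (proj₁ (counts k)) ⟨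
        ∑ℕ n (walk neg ∘ σ k) + countOf σ pos k ∸ 3
          ≡⟨ cong (_∸ 3) (balance (walk neg) (ind pos) (ind neg) (λ { pos → refl ; neg → refl ; none → refl })) ⟩
        n + countOf σ neg k ∸ 3        ≡⟨ cong (λ q → n + q ∸ 3) (proj₂ (counts k)) ⟩
        n + 2 ∸ 3                      ≡⟨ cong (_∸ 3) (+-comm n 2) ⟩
        n ∸ 1                          ∎
      row none = ∑ℕ-zero {n} (λ _ → refl)

-- The sum of `walks` from vertex `zero` is evaluated twice: by the signs of the pairs, with 10 from
-- the diagonal, and by `walks-total`. The witness counts the other vertices not adjacent to `zero`,
-- so there are 6 + m vertices in all.
parameter-equation : ∀ {n} {σ : RawSG (suc n)} (t : EdgeSign → ℕ) →
  (∀ i j → σ i j ≡ σ j i) → (∀ i → σ i i ≡ none) → Regular 5 σ → NetRegular (⁺ 1) σ → (∀ i j → i ≢ j → walks σ i j ≡ t (σ i j)) →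
  ∃ λ m → 3 * t pos + 2 * t neg + m * t none ≡ 21 + 5 * m
parameter-equation {n} {σ} t σ-sym σ-irr regular net-regular walks-off = z , +-cancelˡ-≡ 10 _ _ (begin
  10 + (3 * t pos + 2 * t neg + z * t none)
    ≡⟨ cong (10 +_) (cong₂ (λ p q → p * t pos + q * t neg + z * t none) pos-rest neg-rest) ⟨
  10 + (rest pos * t pos + rest neg * t neg + z * t none)
    ≡⟨ cong₂ _+_ (walks-diagonal v) (∑ℕ-by-sign n (σ v ∘ suc) t) ⟨
  walks σ v v + ∑ℕ n (λ j → t (σ v (suc j)))
    ≡⟨ cong (walks σ v v +_) (∑ℕ-cong (λ j → walks-off v (suc j) (λ ()))) ⟨
  ∑ℕ (suc n) (walks σ v)
    ≡⟨ walks-total v ⟩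
  3 * (suc n + 1) + 2 * n
    ≡⟨ cong (λ n → 3 * (suc n + 1) + 2 * n) size ⟩
  3 * (suc (5 + z) + 1) + 2 * (5 + z)
    ≡⟨ solve 1 (λ z → con 3 :* (con 1 :+ (con 5 :+ z) :+ con 1) :+ con 2 :* (con 5 :+ z) := con 31 :+ con 5 :* z) refl z ⟩
  10 + (21 + 5 * z) ∎)
  where
  open NetRegularFive σ-sym regular net-regular
  open ≡-Reasoning
  open +-*-Solver
  v : Fin (suc n)
  v = zero
  rest : EdgeSign → ℕ
  rest e = ∑ℕ n (λ j → ind e (σ v (suc j)))
  z : ℕ
  z = rest none
  -- Leaving out `v` itself does not change the counts of edges, because its own sign is `none`.
  others : ∀ e → ind e none ≡ 0 → ∀ c → countOf σ e v ≡ c → rest e ≡ c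
  others e eq c count = trans (sym (cong (_+ rest e) (trans (cong (ind e) (σ-irr v)) eq))) count
  pos-rest : rest pos ≡ 3
  pos-rest = others pos refl 3 (proj₁ (counts v))
  neg-rest : rest neg ≡ 2
  neg-rest = others neg refl 2 (proj₂ (counts v))
  size : n ≡ 5 + z
  size = begin
    n                                    ≡⟨ trans (∑ℕ-const n 1) (*-identityʳ n) ⟨
    ∑ℕ n (λ _ → 1)                       ≡⟨ ∑ℕ-by-sign n (σ v ∘ suc) (λ _ → 1) ⟩
    rest pos * 1 + rest neg * 1 + z * 1  ≡⟨ cong₂ (λ p q → p * 1 + q * 1 + z * 1) pos-rest neg-rest ⟩
    5 + z * 1                            ≡⟨ cong (5 +_) (*-identityʳ z) ⟩
    5 + z                                ∎

start-realised : ∀ {n} {σ : RawSG n} → (∀ i → σ i i ≡ none) → (v : Fin n) → Realises σ start (λ _ → v)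
start-realised σ-irr v = record
  { origin    = zero
  ; injective = λ { {zero} {zero} _ → refl }
  ; agrees    = λ { zero zero → subst (just none ⊑_) (sym (σ-irr v)) known }
  }

classification : ∀ n (σ : RawSG n) → Target σ → Iso σ G₂ ⊎ Iso σ S₁₂
-- On no vertices the signed graph is edgeless, which strong regularity excludes.
classification zero σ (_ , _ , (_ , non-empty , _) , _) = contradiction (λ ()) non-empty
classification (suc n) σ
  ((σ-sym , σ-irr) , connected , (_ , _ , _ , a , b , c , _ , a-value , b-value , c-value) , regular , net-regular) =
  -- The bound on `c` comes from a non-adjacent pair, so it is first decided whether one exists.
  conclude (any? (λ i → any? (λ j → ¬? (i ≟ j) ×-dec (σ i j ≟ₛ none))))
  where
  open NetRegularFive σ-sym regular net-regular
  v : Fin (suc n)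
  v = zero
  -- The absolute value loses nothing at entries of A²: adding 5 to them gives a natural number by
  -- `adj²-walks`.
  shift : ℤ → ℕ
  shift x = ∣ x ℤ.+ ⁺ 5 ∣
  shifted : ∀ {i j x} → adj² σ i j ≡ x → walks σ i j ≡ shift x
  shifted {i} {j} refl = cong ∣_∣ (sym (adj²-walks i j))
  bounded : ∀ {i j x} → adj² σ i j ≡ x → shift x < 11
  bounded {i} {j} eq = subst (_< 11) (shifted eq) (walks-≤10 i j)
  pos-count : ∀ v → countOf σ pos v ≡ 3
  pos-count v = proj₁ (counts v)
  neg-count : ∀ v → countOf σ neg v ≡ 2
  neg-count v = proj₂ (counts v)
  a<11 : shift a < 11
  a<11 with w , eq ← neighbour pos v (subst (0 <_) (sym (pos-count v)) (s≤s z≤n)) =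
    bounded (a-value v w eq)
  b<11 : shift b < 11
  b<11 with w , eq ← neighbour neg v (subst (0 <_) (sym (neg-count v)) (s≤s z≤n)) =
    bounded (b-value v w eq)

  conclude-at : ∀ γ → γ < 11 → (∀ i j → i ≢ j → σ i j ≡ none → walks σ i j ≡ γ) → Iso σ G₂ ⊎ Iso σ S₁₂
  conclude-at γ γ<11 none-value = search-sound admissible 300 start (start-realised σ-irr v)
    (settled a<11 b<11 γ<11 (small-multiplicity γ (proj₁ equation) a<11 b<11 (proj₂ equation)))
    where
    walks-off : ∀ i j → i ≢ j → walks σ i j ≡ target (shift a) (shift b) γ (σ i j)
    walks-off i j i≢j with σ i j in eq
    ... | pos  = shifted (a-value i j eq)
    ... | neg  = shifted (b-value i j eq)
    ... | none = none-value i j i≢j eq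
    equation = parameter-equation (target (shift a) (shift b) γ) σ-sym σ-irr regular net-regular walks-off
    admissible : Admissible σ (target (shift a) (shift b) γ)
    admissible = record
      { symmetric = σ-sym
      ; loopless  = σ-irr
      ; connected = connected
      ; pos-count = pos-count
      ; neg-count = neg-count
      ; walks-off = walks-off
      }

  conclude : Dec (∃ λ i → ∃ λ j → i ≢ j × σ i j ≡ none) → Iso σ G₂ ⊎ Iso σ S₁₂
  conclude (yes (i , j , i≢j , eq)) =
    conclude-at (shift c) (bounded (c-value i j i≢j eq)) (λ i j i≢j eq → shifted (c-value i j i≢j eq))
  -- In a complete signed graph c is arbitrary, and any value of γ will do.
  conclude (no all-adjacent) =
    conclude-at 0 (s≤s z≤n) (λ i j i≢j eq → contradiction (i , j , i≢j , eq) all-adjacent)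

-- The two signed graphs satisfy the conditions

ShortPaths : RawSG n → Set
ShortPaths σ = ∀ i j → ∃ λ k → (i ≡ k ⊎ σ i k ≢ none) × (k ≡ j ⊎ σ k j ≢ none)

-- Diameter at most 2 is decided by enumerating vertices, and both graphs have it; either half of
-- the path may be trivial.
shortPaths-connected : {σ : RawSG n} → ShortPaths σ → Connected σ
shortPaths-connected {σ = σ} short i j with k , i—k , k—j ← short i j = hop (hop here i—k) k—j
  where
  hop : ∀ {x y} → Reach σ i x → x ≡ y ⊎ σ x y ≢ none → Reach σ i y
  hop path (inj₁ refl) = path
  hop path (inj₂ edge) = step path edge

-- Every clause is a finite check. One edge of each sign excludes both the edgeless and the
-- homogeneous case.
Certificate : RawSG n → ℕ → ℤ → ℤ → ℤ → Set
Certificate σ r a b c =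
  IsSignedGraph σ × ShortPaths σ × SRSGParams σ r a b c × Regular 5 σ × NetRegular (⁺ 1) σ ×
  ∃ (λ i → ∃ λ j → σ i j ≡ pos) × ∃ (λ i → ∃ λ j → σ i j ≡ neg)

certificate? : ∀ (σ : RawSG n) r a b c → Dec (Certificate σ r a b c)
certificate? σ r a b c =
  (all? (λ i → all? λ j → σ i j ≟ₛ σ j i) ×-dec all? (λ i → σ i i ≟ₛ none)) ×-dec
  all? (λ i → all? λ j → any? λ k → ((i ≟ k) ⊎-dec ¬? (σ i k ≟ₛ none)) ×-dec ((k ≟ j) ⊎-dec ¬? (σ k j ≟ₛ none))) ×-dec
  (all? (λ i → adj² σ i i ℤ.≟ ⁺ r) ×-dec
   all? (λ i → all? λ j → (σ i j ≟ₛ pos) →-dec (adj² σ i j ℤ.≟ a)) ×-dec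
   all? (λ i → all? λ j → (σ i j ≟ₛ neg) →-dec (adj² σ i j ℤ.≟ b)) ×-dec
   all? (λ i → all? λ j → ¬? (i ≟ j) →-dec ((σ i j ≟ₛ none) →-dec (adj² σ i j ℤ.≟ c)))) ×-dec
  all? (λ v → degree σ v ℕ.≟ 5) ×-dec
  all? (λ v → netDegree σ v ℤ.≟ ⁺ 1) ×-dec
  any? (λ i → any? λ j → σ i j ≟ₛ pos) ×-dec
  any? (λ i → any? λ j → σ i j ≟ₛ neg)

certified : ∀ (σ : RawSG n) r a b c → Certificate σ r a b c → Target σ
certified σ r a b c (sg , short , params , regular , net , (i , j , plus) , (i′ , j′ , minus)) =
  sg , shortPaths-connected short , (mixed , non-empty , _ , _ , _ , _ , params) , regular , net
  where
  mixed : ¬ (Homogeneous σ × Complete σ)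
  mixed (inj₁ no-neg , _) = no-neg i′ j′ minus
  mixed (inj₂ no-pos , _) = no-pos i j plus
  non-empty : ¬ Edgeless σ
  non-empty empty with () ← trans (sym plus) (empty i j)

-- The final 0 is a default value for `c`, as a complete graph has no non-adjacent pairs.
G₂-target : Target G₂
G₂-target = certified G₂ 5 (ℤ.- ⁺ 4) (⁺ 4) (⁺ 0) (toWitness {a? = certificate? G₂ 5 (ℤ.- ⁺ 4) (⁺ 4) (⁺ 0)} _)

S₁₂-target : Target S₁₂
S₁₂-target = certified S₁₂ 5 (⁺ 2) (⁺ 1) (ℤ.- ⁺ 2) (toWitness {a? = certificate? S₁₂ 5 (⁺ 2) (⁺ 1) (ℤ.- ⁺ 2)} _)

G₂≇S₁₂ : ¬ Iso G₂ S₁₂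
G₂≇S₁₂ (f , _) = contradiction (↔⇒≡ f) λ ()

theorem3p11 : (Target G₂ × Target S₁₂ × ¬ Iso G₂ S₁₂) ×
    (∀ (n : ℕ) (σ : RawSG n) → Target σ → Iso σ G₂ ⊎ Iso σ S₁₂)
theorem3p11 = (G₂-target , S₁₂-target , G₂≇S₁₂) , classification
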